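{- For all $n\ge 2$, $$\left|\mathrm{Av}_n[\overline{12}34]\right|=\left|\mathrm{Av}_n[\overline{12}43]\right|=1+\sum_{i=0}^{n-2} i\,(i+1)^{n-i-2}.$$
   Context: For $\sigma=\sigma_1\cdots\sigma_n\in S_n$, the cyclic permutation $[\sigma]$ is the set of all rotations of $\sigma$; $[S_n]$ is the set of cyclic permutations of length $n$. A cyclic permutation $[\sigma]$ contains the vincular cyclic pattern $[\overline{ab}cd]$ if some rotation of $\sigma$ has a subsequence $xyzw$ order-isomorphic to $abcd$ with $x,y$ in adjacent positions of that rotation; otherwise it avoids it. $\mathrm{Av}_n[\pi]$ is the set of $[\sigma]\in[S_n]$ avoiding $[\pi]$. -}

module Defs where

open import Data.Nat using (ℕ; zero; suc; _+_; _*_; _∸_; _^_; _≤_; _<_)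
open import Data.List using (List; []; _∷_; _++_; drop; take; length; map; upTo)
open import Data.Nat.ListAction using (sum)
open import Data.List.Relation.Unary.All using (All)
open import Data.List.Relation.Unary.Any using (Any)
open import Data.List.Relation.Unary.AllPairs using (AllPairs)
open import Data.List.Relation.Binary.Permutation.Propositional using (_↭_)
open import Data.Product using (Σ; ∃; ∃-syntax; _×_)
open import Relation.Nullary using (¬_)
open import Relation.Binary.PropositionalEquality using (_≡_)

-- A permutation of length n is a list that is a rearrangement of 0,1,…,n-1
-- (one-line notation σ₁⋯σₙ, values shifted down by one).
IsPerm : ℕ → List ℕ → Set
IsPerm n σ = σ ↭ upTo n

rotate : ℕ → List ℕ → List ℕ
rotate k σ = drop k σ ++ take k σ

RotEquiv : List ℕ → List ℕ → Set
RotEquiv σ τ = ∃[ k ] (k < length σ × τ ≡ rotate k σ)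

-- entry at position i (0-based); default 0 out of range (only used in range)
at : List ℕ → ℕ → ℕ
at []       _       = 0
at (x ∷ xs) zero    = x
at (x ∷ xs) (suc i) = at xs i

record Pat4 : Set where
  constructor pat
  field a b c d : ℕ

OrderIso : Pat4 → Pat4 → Set
OrderIso (pat x y z w) (pat a b c d) =
  (x < y → a < b) × (a < b → x < y) ×
  (x < z → a < c) × (a < c → x < z) ×
  (x < w → a < d) × (a < d → x < w) ×
  (y < x → b < a) × (b < a → y < x) ×
  (y < z → b < c) × (b < c → y < z) ×
  (y < w → b < d) × (b < d → y < w) ×
  (z < x → c < a) × (c < a → z < x) ×
  (z < y → c < b) × (c < b → z < y) ×
  (z < w → c < d) × (c < d → z < w) ×
  (w < x → d < a) × (d < a → w < x) ×
  (w < y → d < b) × (d < b → w < y) ×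
  (w < z → d < c) × (d < c → w < z)

-- the linear word τ contains the vincular pattern \overline{ab}cd:
-- positions i, i+1 (adjacent), k, l with i+1 < k < l < |τ|
LinContains : List ℕ → Pat4 → Set
LinContains τ p = ∃[ i ] ∃[ k ] ∃[ l ]
  (suc i < k × k < l × l < length τ ×
   OrderIso (pat (at τ i) (at τ (suc i)) (at τ k) (at τ l)) p)

CycContains : List ℕ → Pat4 → Set
CycContains σ p = ∃[ τ ] (RotEquiv σ τ × LinContains τ p)

-- |Av_n[π]| = N : there is a complete, irredundant system L of
-- representatives of the cyclic permutations of length n avoiding [π],
-- and it has exactly N elements.
CycAvCount : ℕ → Pat4 → ℕ → Set
CycAvCount n p N = Σ (List (List ℕ)) λ L →
  All (λ σ → IsPerm n σ × ¬ CycContains σ p) L ×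
  AllPairs (λ σ τ → ¬ RotEquiv σ τ) L ×
  (∀ σ → IsPerm n σ → ¬ CycContains σ p → Any (λ ρ → RotEquiv ρ σ) L) ×
  length L ≡ N

p1234 : Pat4
p1234 = pat 1 2 3 4

p1243 : Pat4
p1243 = pat 1 2 4 3

formula : ℕ → ℕ
formula n = 1 + sum (map (λ i → i * suc i ^ (n ∸ i ∸ 2)) (upTo (n ∸ 1)))

{-# OPTIONS --safe #-}
module Submission where

-- Rotate a cyclic permutation so that its maximum M comes first, M u.  It avoids
-- the pattern iff for every ascent x y of the linear word u the letters ≥ y of u
-- are in order: decreasing for 1234, increasing for 1243.  Let t be least such
-- that the letters ≥ t of u are in order; then avoidance means that every ascent
-- top is ≥ t.  If t = 0, u is the one monotone word.  Otherwise, with i letters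
-- ≥ t, u arises uniquely by inserting t-1, t-2, …, 0 in turn, each at the end or
-- in front of a letter ≥ t: there are i + 1 places for each, except that t-1 must
-- not go to its monotone place.  This gives i (i+1)^(t-1) words.

open import Defs
open import Data.List
  using (List; []; _∷_; _++_; [_]; map; concatMap; filter; length; take; drop; upTo)
open import Data.List.Properties
  using (length-map; map-∘; map-id; map-cong; map-upTo; upTo-∷ʳ; ≡-dec;
         filter-accept; filter-reject; filter-all; ++-assoc; ++-identityʳ; ∷-injective; ∷-injectiveʳ;
         length-++; length-++-comm; length-upTo; take++drop≡id)
open import Data.List.Membership.Propositional using (_∈_; find)
open import Data.List.Membership.Propositional.Properties
  using (∈-map⁺; ∈-map⁻; ∈-filter⁺; ∈-filter⁻; ∈-concatMap⁺; ∈-concatMap⁻; ∈-∃++;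
         ∈-upTo⁺; ∈-upTo⁻)
open import Data.List.Relation.Binary.Disjoint.Propositional using (Disjoint)
open import Data.List.Relation.Binary.Permutation.Propositional
  using (_↭_; ↭⇒↭ₛ; ↭-refl; ↭-sym; ↭-trans; ↭-reflexive; prep; swap)
open import Data.List.Relation.Binary.Permutation.Propositional.Properties
  using (map⁺; ↭-map-inv; shift; drop-∷; All-resp-↭; ∈-resp-↭; ↭-length; ↭-empty-inv; ++-comm)
open import Data.List.Relation.Unary.All as All using (All; []; _∷_)
import Data.List.Relation.Unary.All.Properties as All
open import Data.List.Relation.Unary.AllPairs as AllPairs using (AllPairs; []; _∷_)
import Data.List.Relation.Unary.AllPairs.Properties as AllPairs
open import Data.List.Relation.Unary.Any as Any using (Any; here; there)
open import Data.List.Relation.Unary.Unique.Propositional using (Unique)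
import Data.List.Relation.Unary.Unique.Propositional.Properties as Unique
import Data.List.Relation.Binary.Permutation.Setoid.Properties as ↭ₛ
open import Data.Nat
open import Data.Nat.ListAction using (sum)
open import Data.Nat.Properties
open import Data.Product using (∃-syntax; _×_; _,_; proj₁; proj₂) renaming (swap to swap×)
open import Data.Sum using (_⊎_; inj₁; inj₂)
open import Function using (_∘_)
open import Level using (0ℓ)
open import Relation.Binary.Core using (Rel)
open import Relation.Binary.Definitions using (Decidable)
open import Relation.Binary.PropositionalEquality
  using (_≡_; _≢_; refl; sym; trans; cong; cong₂; subst; subst₂; setoid; module ≡-Reasoning)
open import Relation.Nullary using (¬_; yes; no; ¬?; contradiction)
open import Relation.Nullary.Decidable using (True; toWitness)

private
  variable
    A B : Set
    x y t k m : ℕ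
    u v w : List ℕ

-- Duplicates and lengths in concatenated and filtered lists.

concatMap-unique : (f : A → List B) {xs : List A} → Unique xs →
  (∀ {x} → x ∈ xs → Unique (f x)) →
  (∀ {x x′ z} → x ∈ xs → x′ ∈ xs → z ∈ f x → z ∈ f x′ → x ≡ x′) →
  Unique (concatMap f xs)
concatMap-unique f [] _ _ = []
concatMap-unique f {x ∷ xs} (x∉ ∷ xs!) f! sep =
  Unique.++⁺ (f! (here refl))
             (concatMap-unique f xs! (f! ∘ there) (λ p q → sep (there p) (there q)))
             disjoint
  where
  disjoint : Disjoint (f x) (concatMap f xs)
  disjoint (z∈ , z∈′) with x′ , x′∈ , z∈fx′ ← find (∈-concatMap⁻ f z∈′) =
    All.lookup x∉ x′∈ (sep (here refl) (there x′∈) z∈ z∈fx′)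

length-concatMap-const : (f : A → List B) {c : ℕ} (xs : List A) →
  (∀ {x} → x ∈ xs → length (f x) ≡ c) → length (concatMap f xs) ≡ length xs * c
length-concatMap-const f []       eq = refl
length-concatMap-const f (x ∷ xs) eq =
  trans (length-++ (f x)) (cong₂ _+_ (eq (here refl)) (length-concatMap-const f xs (eq ∘ there)))

length-concatMap : (f : A → List B) (xs : List A) →
  length (concatMap f xs) ≡ sum (map (length ∘ f) xs)
length-concatMap f []       = refl
length-concatMap f (x ∷ xs) = trans (length-++ (f x)) (cong (length (f x) +_) (length-concatMap f xs))

_≟ˡ_ = ≡-dec _≟_

delete : List ℕ → List (List ℕ) → List (List ℕ)
delete w = filter (λ u → ¬? (u ≟ˡ w))

length-delete : ∀ {us} → Unique us → w ∈ us → suc (length (delete w us)) ≡ length us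
length-delete {w = w} {u ∷ us} (u∉ ∷ us!) (here refl) =
  cong suc (trans (cong length (filter-reject (λ u → ¬? (u ≟ˡ w)) {xs = us} (λ ne → ne refl)))
                  (cong length (filter-all (λ u → ¬? (u ≟ˡ w)) (All.map (λ ne → ne ∘ sym) u∉))))
length-delete {w = w} {u ∷ us} (u∉ ∷ us!) (there w∈) =
  cong suc (trans (cong length (filter-accept (λ u → ¬? (u ≟ˡ w)) {xs = us} (All.lookup u∉ w∈)))
                  (length-delete us! w∈))

-- Inserting a new minimum

-- Ins t v w: w arises from v by raising all letters by one and inserting 0
-- at the end or in front of a letter that was at least t.
data Ins (t : ℕ) : List ℕ → List ℕ → Set where
  front : All (t ≤_) (take 1 v) → Ins t v (0 ∷ map suc v)
  later : Ins t v w → Ins t (x ∷ v) (suc x ∷ w)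

inserts : ℕ → List ℕ → List (List ℕ)
inserts t []      = [ [ 0 ] ]
inserts t (x ∷ v) with t ≤? x
... | yes _ = (0 ∷ map suc (x ∷ v)) ∷ map (suc x ∷_) (inserts t v)
... | no  _ = map (suc x ∷_) (inserts t v)

∈-inserts⁺ : Ins t v w → w ∈ inserts t v
∈-inserts⁺ {v = []} (front _) = here refl
∈-inserts⁺ {t} {x ∷ v} (front (t≤x ∷ [])) with t ≤? x
... | yes _   = here refl
... | no  t≰x = contradiction t≤x t≰x
∈-inserts⁺ {t} {x ∷ v} (later i) with t ≤? x
... | yes _ = there (∈-map⁺ (suc x ∷_) (∈-inserts⁺ i))
... | no  _ = ∈-map⁺ (suc x ∷_) (∈-inserts⁺ i)

∈-inserts⁻ : w ∈ inserts t v → Ins t v w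
∈-inserts⁻ {v = []} (here refl) = front []
∈-inserts⁻ {t = t} {x ∷ v} w∈ with t ≤? x | w∈
... | yes t≤x | here refl = front (t≤x ∷ [])
... | yes _   | there w∈′ with _ , w∈″ , refl ← ∈-map⁻ (suc x ∷_) w∈′ = later (∈-inserts⁻ w∈″)
... | no  _   | w∈′       with _ , w∈″ , refl ← ∈-map⁻ (suc x ∷_) w∈′ = later (∈-inserts⁻ w∈″)

inserts-unique : ∀ t v → Unique (inserts t v)
inserts-unique t []      = [] ∷ []
inserts-unique t (x ∷ v) with t ≤? x
... | yes _ = All.map⁺ (All.universal (λ _ ()) _) ∷ Unique.map⁺ ∷-injectiveʳ (inserts-unique t v)
... | no  _ = Unique.map⁺ ∷-injectiveʳ (inserts-unique t v)

length-inserts-0 : ∀ v → length (inserts 0 v) ≡ suc (length v)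
length-inserts-0 []      = refl
length-inserts-0 (x ∷ v) = cong suc (trans (length-map (suc x ∷_) (inserts 0 v)) (length-inserts-0 v))

length-inserts-step : ∀ m {x v w} → length (inserts (suc m) w) ≡ length (inserts m v) →
  length (inserts (suc m) (suc x ∷ w)) ≡ length (inserts m (x ∷ v))
length-inserts-step m {x} {v} {w} eq with suc m ≤? suc x | m ≤? x
... | yes _   | yes _   = cong suc (trans (length-map _ (inserts (suc m) w))
                                          (trans eq (sym (length-map _ (inserts m v)))))
... | yes p   | no  m≰x = contradiction (≤-pred p) m≰x
... | no  ¬p  | yes m≤x = contradiction (s≤s m≤x) ¬p
... | no  _   | no  _   = trans (length-map _ (inserts (suc m) w)) (trans eq (sym (length-map _ (inserts m v))))

length-inserts-map-suc : ∀ m v → length (inserts (suc m) (map suc v)) ≡ length (inserts m v)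
length-inserts-map-suc m []      = refl
length-inserts-map-suc m (x ∷ v) = length-inserts-step m {x} {v} (length-inserts-map-suc m v)

-- The new 0 lies below the threshold `suc m`, so it opens no place in front of itself, and all
-- other letters rise together with the threshold. Hence the factor i + 1 stays the same at every
-- later insertion.
length-inserts-Ins : ∀ m → Ins t v w → length (inserts (suc m) w) ≡ length (inserts m v)
length-inserts-Ins {v = v} m (front _) =
  trans (length-map (1 ∷_) (inserts (suc m) (map suc v))) (length-inserts-map-suc m v)
length-inserts-Ins m (later {v = v} {x = x} i) = length-inserts-step m {x} {v} (length-inserts-Ins m i)

-- A left inverse of insertion that does not depend on the threshold: a word has only one parent, so
-- distinct words have no common child.
strip : List ℕ → List ℕ
strip []          = []
strip (0     ∷ w) = map pred w
strip (suc x ∷ w) = x ∷ strip w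

strip-Ins : Ins t v w → strip w ≡ v
strip-Ins {v = v} (front _) = trans (sym (map-∘ v)) (map-id v)
strip-Ins (later i) = cong (_ ∷_) (strip-Ins i)

Ins-↭ : Ins t v w → w ↭ 0 ∷ map suc v
Ins-↭ (front _)         = ↭-refl
Ins-↭ (later {x = x} i) = ↭-trans (prep (suc x) (Ins-↭ i)) (swap (suc x) 0 ↭-refl)

upTo-suc : ∀ k → 0 ∷ map suc (upTo k) ≡ upTo (suc k)
upTo-suc k = cong (0 ∷_) (map-upTo suc k)

Ins-perm : Ins t v w → v ↭ upTo k → w ↭ upTo (suc k)
Ins-perm {k = k} i p = ↭-trans (Ins-↭ i) (↭-trans (prep 0 (map⁺ suc p)) (↭-reflexive (upTo-suc k)))

-- Threshold 0 allows every place, so the 0 may stand anywhere; `Ins-threshold` later raises the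
-- threshold.
Ins-split : ∀ p {s q} → p ++ s ≡ map suc q → Ins 0 q (p ++ 0 ∷ s)
Ins-split []      refl = front (All.universal (λ _ → z≤n) _)
Ins-split (x ∷ p) {q = y ∷ q} eq with refl , eq′ ← ∷-injective eq = later (Ins-split p eq′)

perm-Ins : w ↭ upTo (suc k) → ∃[ v ] (Ins 0 v w × v ↭ upTo k)
perm-Ins {k = k} π with ∈-∃++ (∈-resp-↭ (↭-sym π) (here refl))
... | p , s , refl
  with v , eq , ρ ← ↭-map-inv suc (↭-sym (drop-∷
    (↭-trans (↭-sym (shift 0 p s)) (↭-trans π (↭-reflexive (sym (upTo-suc k)))))))
  = v , Ins-split p eq , ↭-sym ρ

-- Ascents

data Asc (x y : ℕ) : List ℕ → Set where
  here  : x < y → Asc x y (x ∷ y ∷ w)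
  there : ∀ {z} → Asc x y w → Asc x y (z ∷ w)

Tops : ℕ → List ℕ → Set
Tops t w = ∀ {x y} → Asc x y w → t ≤ y

Asc-map-suc⁺ : Asc x y v → Asc (suc x) (suc y) (map suc v)
Asc-map-suc⁺ (here x<y) = here (s≤s x<y)
Asc-map-suc⁺ (there a)  = there (Asc-map-suc⁺ a)

Asc-map-suc⁻ : ∀ v → Asc x y (map suc v) → ∃[ y′ ] ∃[ x′ ] (y ≡ suc y′ × Asc x′ y′ v)
Asc-map-suc⁻ (a ∷ b ∷ v) (here x<y) = b , a , refl , here (≤-pred x<y)
Asc-map-suc⁻ (a ∷ v)     (there p) with y′ , x′ , eq , q ← Asc-map-suc⁻ v p = y′ , x′ , eq , there q

-- Only the top of an ascent survives the insertion: 0 may become its bottom.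
Asc-Ins : Ins t v w → Asc x y v → ∃[ x′ ] Asc x′ (suc y) w
Asc-Ins (front _) a = _ , there (Asc-map-suc⁺ a)
Asc-Ins (later (front _)) (here _)     = _ , there (here (s≤s z≤n))
Asc-Ins (later (later _)) (here x<y)   = _ , here (s≤s x<y)
Asc-Ins (later i)         (there a) with x′ , b ← Asc-Ins i a = x′ , there b

-- The only ascent that can be new has the 0 as its bottom; its top is the raised letter in front of
-- which the 0 was put.
Tops-Ins : Ins t v w → Tops t v → Tops (suc t) w
Tops-Ins {v = z ∷ v} (front (t≤z ∷ [])) tops (here _) = s≤s t≤z
Tops-Ins {v = v} (front _) tops (there a) with _ , _ , refl , b ← Asc-map-suc⁻ v a = s≤s (tops b)
Tops-Ins (later (later _)) tops (here x<y) = s≤s (tops (here (≤-pred x<y)))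
Tops-Ins (later i) tops (there a) = Tops-Ins i (tops ∘ there) a

-- Unless the 0 ends the word it forms an ascent with the next letter, so the ascents with bottom 0
-- reveal its place.
Ins-threshold : Ins 0 v w → (∀ {y} → Asc 0 (suc y) w → t ≤ y) → Ins t v w
Ins-threshold {v = []}    (front _) h = front []
Ins-threshold {v = x ∷ v} (front _) h = front (h (here (s≤s z≤n)) ∷ [])
Ins-threshold (later i) h = later (Ins-threshold i (h ∘ there))

-- Counting the linear words by inserting minima.

OrderedAbove OrderedFrom : Rel ℕ 0ℓ → ℕ → List ℕ → Set
OrderedAbove R t = AllPairs (λ a b → t < a → t < b → R a b)
OrderedFrom  R t = AllPairs (λ a b → t ≤ a → t ≤ b → R a b)

-- Both patterns share this count: `R` is the order required of the large letters, and `place` is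
-- the one insertion of a new minimum that keeps a sorted word sorted.
module Linear
  (R : Rel ℕ 0ℓ)
  (R-suc : ∀ {a b} → R a b → R (suc a) (suc b))
  (R-pred : ∀ {a b} → R (suc a) (suc b) → R a b)
  (place : List ℕ → List ℕ)
  (place-Ins : ∀ v → Ins 0 v (place v))
  (place-sorted : ∀ {v} → AllPairs R v → AllPairs R (place v))
  (place-only : ∀ {v w} → Ins 0 v w → AllPairs R w → w ≡ place v)
  where

  SortedFrom : ℕ → List ℕ → Set
  SortedFrom = OrderedFrom R

  Good : List ℕ → Set
  Good u = ∀ {x y} → Asc x y u → SortedFrom y u

  SortedFrom-mono : x ≤ y → SortedFrom x u → SortedFrom y u
  SortedFrom-mono x≤y = AllPairs.map (λ r y≤a y≤b → r (≤-trans x≤y y≤a) (≤-trans x≤y y≤b))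

  -- The new 0 is below `suc m` and is never compared; the other letters rise by one along with the
  -- threshold.
  SortedFrom-Ins⁺ : Ins t v w → SortedFrom m v → SortedFrom (suc m) w
  SortedFrom-Ins⁺ (front _) s =
    All.universal (λ _ ()) _ ∷
    AllPairs.map⁺ (AllPairs.map (λ r p q → R-suc (r (≤-pred p) (≤-pred q))) s)
  SortedFrom-Ins⁺ (later i) (r ∷ s) =
    -- How the head compares with the remaining letters does not depend on their order, so the 0 may
    -- be assumed to come first among them.
    All-resp-↭ (↭-sym (Ins-↭ i))
      ((λ _ ()) ∷ All.map⁺ (All.map (λ r p q → R-suc (r (≤-pred p) (≤-pred q))) r)) ∷
    SortedFrom-Ins⁺ i s

  SortedFrom-Ins⁻ : Ins t v w → SortedFrom (suc m) w → SortedFrom m v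
  SortedFrom-Ins⁻ (front _) (_ ∷ s) =
    AllPairs.map (λ r p q → R-pred (r (s≤s p) (s≤s q))) (AllPairs.map⁻ s)
  SortedFrom-Ins⁻ (later i) (r ∷ s) =
    All.map (λ r p q → R-pred (r (s≤s p) (s≤s q))) (All.map⁻ (All.tail (All-resp-↭ (Ins-↭ i) r))) ∷
    SortedFrom-Ins⁻ i s

  -- Each ascent top y of the parent survives as `suc y` in the child, so the condition at that top
  -- can be pulled back.
  Good-Ins⁻ : Ins t v w → Good w → Good v
  Good-Ins⁻ i good a = SortedFrom-Ins⁻ i (good (proj₂ (Asc-Ins i a)))

  sorted : ℕ → List ℕ
  sorted zero    = []
  sorted (suc k) = place (sorted k)

  sorted-sorted : ∀ k → AllPairs R (sorted k)
  sorted-sorted zero    = []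
  sorted-sorted (suc k) = place-sorted (sorted-sorted k)

  sorted-perm : ∀ k → sorted k ↭ upTo k
  sorted-perm zero    = ↭-refl
  sorted-perm (suc k) = Ins-perm (place-Ins (sorted k)) (sorted-perm k)

  length-sorted : ∀ k → length (sorted k) ≡ k
  length-sorted k = trans (↭-length (sorted-perm k)) (length-upTo k)

  -- The words on m + 1 + i letters with all ascent tops above m, in which m + 1
  -- is the least t such that the letters ≥ t are in order.
  block : ℕ → ℕ → List (List ℕ)
  block i zero    = delete (sorted (suc i)) (inserts 0 (sorted i))
  block i (suc m) = concatMap (inserts (suc m)) (block i m)

  -- The invariant kept by the insertions. `children` counts the places for the next minimum, which
  -- gives the length of the next block.
  record InBlock (i m : ℕ) (w : List ℕ) : Set where
    field
      perm     : w ↭ upTo (suc (m + i))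
      tops     : Tops (suc m) w
      inOrder  : SortedFrom (suc m) w
      maximal  : ¬ SortedFrom m w
      children : length (inserts (suc m) w) ≡ suc i
  open InBlock

  InBlock-Ins : ∀ {i} → InBlock i m v → Ins (suc m) v w → InBlock i (suc m) w
  InBlock-Ins b j .perm     = Ins-perm j (perm b)
  InBlock-Ins b j .tops     = Tops-Ins j (tops b)
  InBlock-Ins b j .inOrder  = SortedFrom-Ins⁺ j (inOrder b)
  InBlock-Ins b j .maximal  = maximal b ∘ SortedFrom-Ins⁻ j
  InBlock-Ins b j .children = trans (length-inserts-Ins _ j) (children b)

  ∈-concatMap-inserts⁻ : ∀ {us} → w ∈ concatMap (inserts t) us → ∃[ v ] (v ∈ us × Ins t v w)
  ∈-concatMap-inserts⁻ {t = t} w∈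
    with v , v∈ , w∈v ← find (∈-concatMap⁻ (inserts t) w∈) = v , v∈ , ∈-inserts⁻ w∈v

  block-sound : ∀ i m → w ∈ block i m → InBlock i m w
  block-sound {w} i zero w∈
    with w∈′ , w≢ ← ∈-filter⁻ (λ u → ¬? (u ≟ˡ sorted (suc i))) {xs = inserts 0 (sorted i)} w∈
    = record
    { perm     = Ins-perm j (sorted-perm i)
    ; tops     = Tops-Ins j (λ _ → z≤n)
    ; inOrder  = SortedFrom-Ins⁺ j (AllPairs.map (λ r _ _ → r) (sorted-sorted i))
    -- Being in order from 0 means being sorted, and the only sorted insertion is the deleted word.
    ; maximal  = λ s → w≢ (place-only j (AllPairs.map (λ r → r z≤n z≤n) s))
    ; children = trans (length-inserts-Ins 0 j) (trans (length-inserts-0 (sorted i)) (cong suc (length-sorted i)))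
    }
    where j = ∈-inserts⁻ w∈′
  block-sound i (suc m) w∈
    with v , v∈ , j ← ∈-concatMap-inserts⁻ {us = block i m} w∈ = InBlock-Ins (block-sound i m v∈) j

  block-unique : ∀ i m → Unique (block i m)
  block-unique i zero    = Unique.filter⁺ (λ u → ¬? (u ≟ˡ sorted (suc i))) (inserts-unique 0 (sorted i))
  block-unique i (suc m) =
    concatMap-unique (inserts (suc m)) (block-unique i m) (λ {v} _ → inserts-unique (suc m) v)
      (λ _ _ p q → trans (sym (strip-Ins (∈-inserts⁻ p))) (strip-Ins (∈-inserts⁻ q)))

  length-block : ∀ i m → length (block i m) ≡ i * suc i ^ m
  length-block i zero = begin
    length (block i zero)
      -- The deleted word `sorted (suc i)` is `place (sorted i)`, which is among the insertions.
      ≡⟨ cong pred (length-delete (inserts-unique 0 (sorted i)) (∈-inserts⁺ (place-Ins (sorted i)))) ⟩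
    pred (length (inserts 0 (sorted i))) ≡⟨ cong pred (length-inserts-0 (sorted i)) ⟩
    length (sorted i)              ≡⟨ length-sorted i ⟩
    i                              ≡⟨ *-identityʳ i ⟨
    i * 1                          ∎
    where open ≡-Reasoning
  length-block i (suc m) = begin
    length (block i (suc m))
      ≡⟨ length-concatMap-const (inserts (suc m)) (block i m) (children ∘ block-sound i m) ⟩
    length (block i m) * suc i     ≡⟨ cong (_* suc i) (length-block i m) ⟩
    i * suc i ^ m * suc i          ≡⟨ *-assoc i (suc i ^ m) (suc i) ⟩
    i * (suc i ^ m * suc i)        ≡⟨ cong (i *_) (*-comm (suc i ^ m) (suc i)) ⟩
    i * suc i ^ suc m              ∎
    where open ≡-Reasoning

  -- Induction by removing the minimum. A sorted parent yields the sorted word or a word of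
  -- `block k 0`; a parent in `block i m` yields a word of `block i (suc m)`.
  block-complete : ∀ k {u} → u ↭ upTo k → Good u →
    u ≡ sorted k ⊎ (∃[ i ] ∃[ m ] (suc (m + i) ≡ k × u ∈ block i m))
  block-complete zero π good = inj₁ (↭-empty-inv π)
  block-complete (suc k) {u} π good with perm-Ins π
  ... | v , j , ρ with block-complete k ρ (Good-Ins⁻ j good)
  ... | inj₁ refl with u ≟ˡ sorted (suc k)
  ...   | yes eq = inj₁ eq
  ...   | no  ne = inj₂ (k , 0 , refl , ∈-filter⁺ (λ u → ¬? (u ≟ˡ sorted (suc k))) (∈-inserts⁺ j) ne)
  block-complete (suc k) π good | v , j , ρ | inj₂ (i , m , eq , v∈) =
    inj₂ (i , suc m , cong suc eq , ∈-concatMap⁺ (inserts (suc m)) (Any.map (λ { refl → ∈-inserts⁺ j′ }) v∈))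
    where
    -- An ascent from 0 to `suc y` with y at most m would make the parent in order from m already,
    -- against `maximal`.
    above : ∀ {y} → Asc 0 (suc y) _ → suc m ≤ y
    above {y} a with suc m ≤? y
    ... | yes m<y = m<y
    ... | no  m≮y = contradiction (SortedFrom-mono (≤-pred (≰⇒> m≮y)) (SortedFrom-Ins⁻ j (good a)))
                                  (maximal (block-sound i m v∈))
    j′ = Ins-threshold j above

  -- The depth is the exponent n - i - 2 for n = k + 1, written as in `formula`. By `depth`, the
  -- subtraction does not truncate when i < k.
  blockOf : ℕ → ℕ → List (List ℕ)
  blockOf k i = block i (suc k ∸ i ∸ 2)

  words : ℕ → List (List ℕ)
  words k = sorted k ∷ concatMap (blockOf k) (upTo k)

  depth : ∀ {i} → i < k → suc (suc k ∸ i ∸ 2 + i) ≡ k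
  depth {suc k} {i} (s≤s i≤k) = cong suc (begin
    (suc (suc k) ∸ i ∸ 2) + i  ≡⟨ cong (_+ i) (∸-+-assoc (suc (suc k)) i 2) ⟩
    (suc (suc k) ∸ (i + 2)) + i ≡⟨ cong (λ z → (suc (suc k) ∸ z) + i) (+-comm i 2) ⟩
    (k ∸ i) + i                ≡⟨ m∸n+n≡m i≤k ⟩
    k                          ∎)
    where open ≡-Reasoning

  words-sound : ∀ k → All (λ u → u ↭ upTo k × Good u) (words k)
  words-sound k =
    (sorted-perm k , λ _ → AllPairs.map (λ r _ _ → r) (sorted-sorted k)) ∷ All.tabulate inBlock
    where
    inBlock : ∀ {u} → u ∈ concatMap (blockOf k) (upTo k) → u ↭ upTo k × Good u
    inBlock u∈ with i , i∈ , u∈b ← find (∈-concatMap⁻ (blockOf k) {xs = upTo k} u∈) =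
      -- Every ascent top is at least the threshold from which the word is in order.
      subst (λ n → _ ↭ upTo n) (depth (∈-upTo⁻ i∈)) (perm b) , λ a → SortedFrom-mono (tops b a) (inOrder b)
      where b = block-sound i _ u∈b

  -- If m < m′, the first membership puts the word in order from m + 1, hence from m′, which the
  -- second one denies.
  block-disjoint : ∀ {i i′ m m′} → w ∈ block i m → w ∈ block i′ m′ → ¬ m < m′
  block-disjoint {i = i} {i′} p q m<m′ =
    maximal (block-sound i′ _ q) (SortedFrom-mono m<m′ (inOrder (block-sound i _ p)))

  words-unique : ∀ k → Unique (words k)
  words-unique k =
    All.tabulate sorted∉ ∷
    concatMap-unique (blockOf k) (Unique.upTo⁺ k) (λ {i} _ → block-unique i (suc k ∸ i ∸ 2)) same
    where
    sorted∉ : ∀ {u} → u ∈ concatMap (blockOf k) (upTo k) → sorted k ≢ u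
    sorted∉ u∈ refl with i , i∈ , u∈b ← find (∈-concatMap⁻ (blockOf k) {xs = upTo k} u∈) =
      maximal (block-sound i (suc k ∸ i ∸ 2) u∈b) (AllPairs.map (λ r _ _ → r) (sorted-sorted k))
    same : ∀ {i i′ z} → i ∈ upTo k → i′ ∈ upTo k → z ∈ blockOf k i → z ∈ blockOf k i′ → i ≡ i′
    same {i} {i′} i∈ i′∈ p q =
      +-cancelˡ-≡ (suc k ∸ i ∸ 2) i i′
        (suc-injective (trans (depth (∈-upTo⁻ i∈))
          (trans (sym (depth (∈-upTo⁻ i′∈))) (cong (λ m → suc (m + i′)) (sym m≡m′)))))
      where
      m≡m′ = ≤-antisym (≮⇒≥ (block-disjoint {i = i′} {i} q p)) (≮⇒≥ (block-disjoint {i = i} {i′} p q))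

  words-complete : ∀ k → u ↭ upTo k → Good u → u ∈ words k
  words-complete k π good with block-complete k π good
  ... | inj₁ eq = here eq
  ... | inj₂ (i , m , eq , u∈) =
    there (∈-concatMap⁺ (blockOf k) (Any.map (λ { refl → subst (λ m → _ ∈ block i m) m≡ u∈ }) (∈-upTo⁺ i<k)))
    where
    i<k : i < k
    i<k = ≤-trans (s≤s (m≤n+m i m)) (≤-reflexive eq)
    m≡ : m ≡ suc k ∸ i ∸ 2
    m≡ = +-cancelʳ-≡ i m _ (suc-injective (trans eq (sym (depth i<k))))

  length-words : ∀ k → length (words k) ≡ formula (suc k)
  length-words k = cong suc (trans (length-concatMap (blockOf k) (upTo k))
    (cong sum (map-cong (λ i → length-block i (suc k ∸ i ∸ 2)) (upTo k))))

-- Rotations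

-- Rotation as an exchange of two factors, which avoids index arithmetic.
Rot : List ℕ → List ℕ → Set
Rot σ τ = ∃[ a ] ∃[ b ] (σ ≡ a ++ b × τ ≡ b ++ a)

-- Levi's lemma for words; it compares the cut points when two rotations are composed.
++-levi : ∀ (a b c d : List A) → a ++ b ≡ c ++ d →
  (∃[ e ] (c ≡ a ++ e × b ≡ e ++ d)) ⊎ (∃[ e ] (a ≡ c ++ e × d ≡ e ++ b))
++-levi []      b c       d eq = inj₁ (c , refl , eq)
++-levi (x ∷ a) b []      d eq = inj₂ (x ∷ a , refl , sym eq)
++-levi (x ∷ a) b (y ∷ c) d eq with refl , eq′ ← ∷-injective eq | ++-levi a b c d (∷-injectiveʳ eq)
... | inj₁ (e , p , q) = inj₁ (e , cong (x ∷_) p , q)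
... | inj₂ (e , p , q) = inj₂ (e , cong (x ∷_) p , q)

Rot-trans : ∀ {ρ σ τ} → Rot ρ σ → Rot σ τ → Rot ρ τ
Rot-trans (a , b , refl , refl) (c , d , eq , refl) with ++-levi b a c d eq
... | inj₁ (e , refl , refl) = e , d ++ b , ++-assoc e d b , sym (++-assoc d b e)
... | inj₂ (e , refl , refl) = a ++ c , e , sym (++-assoc a c e) , ++-assoc e a c

take-length-++ : ∀ (a b : List A) → take (length a) (a ++ b) ≡ a
take-length-++ []      b = refl
take-length-++ (x ∷ a) b = cong (x ∷_) (take-length-++ a b)

drop-length-++ : ∀ (a b : List A) → drop (length a) (a ++ b) ≡ b
drop-length-++ []      b = refl
drop-length-++ (x ∷ a) b = drop-length-++ a b

Rot⇒RotEquiv : ∀ {σ τ} → 0 < length σ → Rot σ τ → RotEquiv σ τ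
-- An empty second factor would give the index `length σ`, which is out of range; index 0 gives the
-- same rotation.
Rot⇒RotEquiv 0<∣σ∣ (a , [] , refl , refl) = 0 , 0<∣σ∣ , sym (trans (++-identityʳ (a ++ [])) (++-identityʳ a))
Rot⇒RotEquiv _ (a , b@(_ ∷ _) , refl , refl) =
  length a ,
  subst (length a <_) (sym (length-++ a)) (m<m+n (length a) (s≤s z≤n)) ,
  sym (cong₂ _++_ (drop-length-++ a b) (take-length-++ a b))

RotEquiv⇒Rot : ∀ {σ τ} → RotEquiv σ τ → Rot σ τ
RotEquiv⇒Rot {σ} (k , _ , eq) = take k σ , drop k σ , sym (take++drop≡id k σ) , eq

length-Rot : ∀ {σ τ} → Rot σ τ → length σ ≡ length τ
length-Rot (a , b , refl , refl) = length-++-comm a b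

-- A nontrivial rotation starting with M would need a second M inside u.
Rot-max-head-injective : ∀ {M u v} → All (_< M) u → Rot (M ∷ u) (M ∷ v) → u ≡ v
Rot-max-head-injective u<M ([] , _ , refl , eq) = sym (∷-injectiveʳ (trans eq (++-identityʳ _)))
Rot-max-head-injective u<M (_ ∷ a , [] , refl , refl) = ++-identityʳ a
Rot-max-head-injective u<M (_ ∷ a , _ ∷ b , refl , refl) =
  contradiction (All.head (All.++⁻ʳ a u<M)) (<-irrefl refl)

-- Occurrences by position

AllPairs-++⁻ : ∀ {R : Rel A 0ℓ} xs {ys} → AllPairs R (xs ++ ys) →
  AllPairs R xs × AllPairs R ys × All (λ x → All (R x) ys) xs
AllPairs-++⁻ []       rs = [] , rs , []
AllPairs-++⁻ (x ∷ xs) (r ∷ rs) with p , q , c ← AllPairs-++⁻ xs rs =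
  All.++⁻ˡ xs r ∷ p , q , All.++⁻ʳ xs r ∷ c

All⇒AllPairs : ∀ {P : A → Set} {xs} → All P xs → AllPairs (λ x y → P x × P y) xs
All⇒AllPairs []       = []
All⇒AllPairs (p ∷ ps) = All.map (p ,_) ps ∷ All⇒AllPairs ps

All-at : ∀ {P : ℕ → Set} {l} → All P w → l < length w → P (at w l)
All-at {l = zero}  (p ∷ _)  _         = p
All-at {l = suc l} (_ ∷ ps) (s≤s l<n) = All-at ps l<n

AllPairs-at : ∀ {R : Rel ℕ 0ℓ} {k l} → AllPairs R w → k < l → l < length w → R (at w k) (at w l)
AllPairs-at {k = zero}  {suc l} (r ∷ _)  _         (s≤s l<n) = All-at r l<n
AllPairs-at {k = suc k} {suc l} (_ ∷ rs) (s≤s k<l) (s≤s l<n) = AllPairs-at rs k<l l<n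

at-All : ∀ {P : ℕ → Set} w → (∀ l → l < length w → P (at w l)) → All P w
at-All []      h = []
at-All (x ∷ w) h = h 0 (s≤s z≤n) ∷ at-All w (λ l → h (suc l) ∘ s≤s)

at-AllPairs : ∀ {R : Rel ℕ 0ℓ} w → (∀ k l → k < l → l < length w → R (at w k) (at w l)) → AllPairs R w
at-AllPairs []      h = []
at-AllPairs (x ∷ w) h =
  at-All w (λ l l<n → h 0 (suc l) (s≤s z≤n) (s≤s l<n)) ∷
  at-AllPairs w (λ k l k<l l<n → h (suc k) (suc l) (s≤s k<l) (s≤s l<n))

-- Cutting at the adjacent pair leaves both later positions in the final factor, shifted down by i +
-- 2.
at-split : ∀ τ i {k l} → suc i < k → k < l → l < length τ →
  ∃[ a ] ∃[ b ] ∃[ k′ ] ∃[ l′ ] (τ ≡ a ++ at τ i ∷ at τ (suc i) ∷ b ×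
    k′ < l′ × l′ < length b × at b k′ ≡ at τ k × at b l′ ≡ at τ l)
at-split (x ∷ y ∷ b) zero {suc (suc k)} {suc (suc l)} (s≤s (s≤s _)) (s≤s (s≤s k<l)) (s≤s (s≤s l<n)) =
  [] , b , k , l , refl , k<l , l<n , refl , refl
at-split (x ∷ τ) (suc i) {suc k} {suc l} (s≤s i<k) (s≤s k<l) (s≤s l<n)
  with a , b , k′ , l′ , eq , rest ← at-split τ i i<k k<l l<n = x ∷ a , b , k′ , l′ , cong (x ∷_) eq , rest

Asc-split : Asc x y u → ∃[ p ] ∃[ s ] (u ≡ p ++ x ∷ y ∷ s × x < y)
Asc-split (here {w = s} x<y) = [] , s , refl , x<y
Asc-split (there {z = z} a) with p , s , eq , x<y ← Asc-split a = z ∷ p , s , cong (z ∷_) eq , x<y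

Asc-join : ∀ p {s} → x < y → Asc x y (p ++ x ∷ y ∷ s)
Asc-join []      x<y = here x<y
Asc-join (z ∷ p) x<y = there (Asc-join p x<y)

-- From cyclic to linear order conditions.

-- From an ascent xy of the cyclic word M p x y s with maximum M one reads on
-- cyclically through s M p; this is turned into a condition on the linear word.
Linearizes : Rel ℕ 0ℓ → Set
Linearizes R = ∀ {M x y} p s → x < y → y < M → All (_< M) p → All (_< M) s →
  (OrderedFrom R y (p ++ x ∷ y ∷ s) → OrderedAbove R y (s ++ M ∷ p)) ×
  (All (_≢ y) p → All (_≢ y) s → OrderedAbove R y (s ++ M ∷ p) → OrderedFrom R y (p ++ x ∷ y ∷ s))

vacuous : ∀ {P : Set} → x ≤ y → y < x → P
vacuous x≤y y<x = contradiction x≤y (<⇒≱ y<x)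

-- Both sides force s to stay at or below y: on the linear side y precedes s, on the cyclic side a
-- larger letter of s would precede M. What remains is that the large letters of p decrease.
≥-linearizes : Linearizes _≥_
≥-linearizes {M} {x} {y} p s x<y y<M p<M s<M = to , from
  where
  to : OrderedFrom _≥_ y (p ++ x ∷ y ∷ s) → OrderedAbove _≥_ y (s ++ M ∷ p)
  to g with gp , _ ∷ gy ∷ _ , _ ← AllPairs-++⁻ p g =
    AllPairs.++⁺
      (AllPairs.map (λ (z≤y , _) y<z → vacuous z≤y y<z) (All⇒AllPairs s≤y))
      (All.map (λ w<M _ _ → <⇒≤ w<M) p<M ∷ AllPairs.map (λ r y<z y<w → r (<⇒≤ y<z) (<⇒≤ y<w)) gp)
      (All.map (λ z≤y → All.universal (λ _ y<z → vacuous z≤y y<z) _) s≤y)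
    where
    s≤y : All (_≤ y) s
    s≤y = All.map (λ r → ≮⇒≥ (λ y<w → vacuous (r ≤-refl (<⇒≤ y<w)) y<w)) gy

  from : All (_≢ y) p → All (_≢ y) s → OrderedAbove _≥_ y (s ++ M ∷ p) → OrderedFrom _≥_ y (p ++ x ∷ y ∷ s)
  from p≢y _ c with _ , _ ∷ cp , csM ← AllPairs-++⁻ s c =
    AllPairs.++⁺
      (AllPairs.zipWith (λ ((z≢y , w≢y) , r) y≤z y≤w → r (≤∧≢⇒< y≤z (z≢y ∘ sym)) (≤∧≢⇒< y≤w (w≢y ∘ sym)))
        (All⇒AllPairs p≢y , cp))
      (All.universal (λ _ y≤x → vacuous y≤x x<y) _ ∷
       All.map (λ w≤y _ _ → w≤y) s≤y ∷
       AllPairs.map (λ (_ , w≤y) y≤z _ → ≤-trans w≤y y≤z) (All⇒AllPairs s≤y))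
      (All.universal (λ _ → (λ _ y≤x → vacuous y≤x x<y) ∷ (λ y≤z _ → y≤z) ∷
                           All.map (λ w≤y y≤z _ → ≤-trans w≤y y≤z) s≤y) p)
    where
    s≤y : All (_≤ y) s
    s≤y = All.zipWith (λ (z<M , r) → ≮⇒≥ (λ y<z → vacuous (All.head r y<z y<M) z<M)) (s<M , csM)

-- Here p is forced to stay at or below y, since it precedes y in the linear word and follows M in
-- the cyclic one. What remains is that the large letters of s increase.
≤-linearizes : Linearizes _≤_
≤-linearizes {M} {x} {y} p s x<y y<M p<M s<M = to , from
  where
  to : OrderedFrom _≤_ y (p ++ x ∷ y ∷ s) → OrderedAbove _≤_ y (s ++ M ∷ p)
  to g with _ , _ ∷ _ ∷ gs , gc ← AllPairs-++⁻ p g =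
    AllPairs.++⁺
      (AllPairs.map (λ r y<z y<w → r (<⇒≤ y<z) (<⇒≤ y<w)) gs)
      (All.map (λ w≤y _ y<w → vacuous w≤y y<w) p≤y ∷
       AllPairs.map (λ (z≤y , _) y<z → vacuous z≤y y<z) (All⇒AllPairs p≤y))
      (All.map (λ z<M → (λ _ _ → <⇒≤ z<M) ∷ All.map (λ w≤y _ y<w → vacuous w≤y y<w) p≤y) s<M)
    where
    p≤y : All (_≤ y) p
    p≤y = All.map (λ { (_ ∷ r ∷ _) → ≮⇒≥ (λ y<z → vacuous (r (<⇒≤ y<z) ≤-refl) y<z) }) gc

  from : All (_≢ y) p → All (_≢ y) s → OrderedAbove _≤_ y (s ++ M ∷ p) → OrderedFrom _≤_ y (p ++ x ∷ y ∷ s)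
  from _ s≢y c with cs , cM ∷ _ , _ ← AllPairs-++⁻ s c =
    AllPairs.++⁺
      (AllPairs.map (λ (z≤y , _) _ y≤w → ≤-trans z≤y y≤w) (All⇒AllPairs p≤y))
      (All.universal (λ _ y≤x → vacuous y≤x x<y) _ ∷
       All.universal (λ _ _ y≤w → y≤w) s ∷
       AllPairs.zipWith (λ ((z≢y , w≢y) , r) y≤z y≤w → r (≤∧≢⇒< y≤z (z≢y ∘ sym)) (≤∧≢⇒< y≤w (w≢y ∘ sym)))
         (All⇒AllPairs s≢y , cs))
      (All.map (λ z≤y → (λ _ y≤x → vacuous y≤x x<y) ∷ (λ _ _ → z≤y) ∷
                         All.universal (λ _ _ y≤w → ≤-trans z≤y y≤w) s) p≤y)
    where
    p≤y : All (_≤ y) p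
    p≤y = All.zipWith (λ (w<M , r) → ≮⇒≥ (λ y<w → vacuous (r y<M y<w) w<M)) (p<M , cM)

-- Cyclic avoidance and its count for one pattern.

Unique-resp-↭ : u ↭ v → Unique u → Unique v
Unique-resp-↭ = λ π → ↭ₛ.Unique-resp-↭ (setoid ℕ) (↭⇒↭ₛ π)

upTo-snoc-↭ : ∀ k → k ∷ upTo k ↭ upTo (suc k)
upTo-snoc-↭ k = ↭-trans (++-comm [ k ] (upTo k)) (↭-reflexive (upTo-∷ʳ k))

perm-bounded : u ↭ upTo k → All (_< k) u
perm-bounded π = All-resp-↭ (↭-sym π) (All.tabulate ∈-upTo⁻)

module Cyclic
  (p : Pat4)
  (R : Rel ℕ 0ℓ)
  (R? : Decidable R)
  (iso⁻ : ∀ {x y z w} → OrderIso (pat x y z w) p → x < y × y < z × y < w × ¬ R z w)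
  (iso⁺ : ∀ {x y z w} → x < y → y < z → y < w → ¬ R z w → OrderIso (pat x y z w) p)
  (linearizes : Linearizes R)
  (R-suc : ∀ {a b} → R a b → R (suc a) (suc b))
  (R-pred : ∀ {a b} → R (suc a) (suc b) → R a b)
  (place : List ℕ → List ℕ)
  (place-Ins : ∀ v → Ins 0 v (place v))
  (place-sorted : ∀ {v} → AllPairs R v → AllPairs R (place v))
  (place-only : ∀ {v w} → Ins 0 v w → AllPairs R w → w ≡ place v)
  where

  open Linear R R-suc R-pred place place-Ins place-sorted place-only

  -- Any cyclic ascent can be rotated to the front, so that all other letters are read after it.
  CycGood : List ℕ → Set
  CycGood σ = ∀ {x y b} → Rot σ (x ∷ y ∷ b) → x < y → OrderedAbove R y b

  CycGood⇒avoids : ∀ {σ} → CycGood σ → ¬ CycContains σ p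
  CycGood⇒avoids good (τ , στ , i , k , l , i<k , k<l , l<n , iso)
    with x<y , y<z , y<w , ¬r ← iso⁻ iso
       | a , b , k′ , l′ , eq , k′<l′ , l′<n , eqₖ , eqₗ ← at-split τ i i<k k<l l<n
    -- Rotating the prefix `a` to the back leaves both letters inside `b`, in the same order.
    = ¬r (subst₂ R eqₖ eqₗ
        (AllPairs-at (proj₁ (AllPairs-++⁻ b (good (Rot-trans (RotEquiv⇒Rot στ) (a , _ , eq , refl)) x<y)))
          k′<l′ l′<n (subst (_ <_) (sym eqₖ) y<z) (subst (_ <_) (sym eqₗ) y<w)))

  avoids⇒CycGood : ∀ {σ} → ¬ CycContains σ p → CycGood σ
  avoids⇒CycGood {σ} av {x} {y} {b} r x<y = at-AllPairs b above
    where
    above : ∀ k l → k < l → l < length b → y < at b k → y < at b l → R (at b k) (at b l)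
    above k l k<l l<n y<z y<w with R? (at b k) (at b l)
    ... | yes r′ = r′
    ... | no ¬r = contradiction
      ( x ∷ y ∷ b , Rot⇒RotEquiv (subst (0 <_) (sym (length-Rot r)) (s≤s z≤n)) r
      , 0 , suc (suc k) , suc (suc l) , s≤s (s≤s z≤n) , s≤s (s≤s k<l) , s≤s (s≤s l<n)
      , iso⁺ x<y y<z y<w ¬r ) av

  -- No ascent starts at the maximum M, and for the ascent ending at M no letter lies above its top.
  -- Every other cyclic ascent lies inside u.
  Good⇒CycGood : ∀ {M u} → All (_< M) u → Good u → CycGood (M ∷ u)
  Good⇒CycGood u<M good ([] , _ , refl , eq) M<y
    with refl ← trans eq (++-identityʳ _) = contradiction (All.head u<M) (<⇒≯ M<y)
  Good⇒CycGood u<M good (a@(_ ∷ _) , [] , eq , refl) M<y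
    with refl ← trans eq (++-identityʳ a) = contradiction (All.head u<M) (<⇒≯ M<y)
  Good⇒CycGood u<M good (M ∷ a , x ∷ [] , refl , refl) _ =
    AllPairs.map (λ (z<M , _) M<z → contradiction M<z (<⇒≯ z<M)) (All⇒AllPairs (All.++⁻ˡ a u<M))
  Good⇒CycGood u<M good (M ∷ a , x ∷ y ∷ s , refl , refl) x<y
    with a<M , (_ ∷ y<M ∷ s<M) ← All.++⁻ a u<M =
    proj₁ (linearizes a s x<y y<M a<M s<M) (good (Asc-join a x<y))

  -- Distinctness of letters keeps y out of the rest of the word, which closes the gap between
  -- letters above y and letters from y on.
  CycGood⇒Good : ∀ {M u} → All (_< M) u → Unique u → CycGood (M ∷ u) → Good u
  CycGood⇒Good {M} u<M u! good asc with a , s , refl , x<y ← Asc-split asc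
    with a<M , (_ ∷ y<M ∷ s<M) ← All.++⁻ a u<M
       | _ , (_ ∷ y∉s ∷ _) , a∉ ← AllPairs-++⁻ a u! =
    proj₂ (linearizes a s x<y y<M a<M s<M)
      (All.map (λ { (_ ∷ z≢y ∷ _) → z≢y }) a∉)
      (All.map (λ y≢w → y≢w ∘ sym) y∉s)
      (good (M ∷ a , _ , refl , refl) x<y)

  avCount : ∀ k → CycAvCount (suc k) p (formula (suc k))
  -- The maximum of a permutation of length `suc k` is k; each class is represented by its rotation
  -- starting there.
  avCount k = map (k ∷_) (words k) , All.map⁺ (All.map sound (words-sound k)) ,
    AllPairs.map⁺ (AllPairs.zipWith irredundant
      (words-unique k , All⇒AllPairs (All.map (perm-bounded ∘ proj₁) (words-sound k)))) ,
    complete ,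
    trans (length-map (k ∷_) (words k)) (length-words k)
    where
    sound : ∀ {u} → u ↭ upTo k × Good u → IsPerm (suc k) (k ∷ u) × ¬ CycContains (k ∷ u) p
    sound (π , good) = ↭-trans (prep k π) (upTo-snoc-↭ k) ,
      CycGood⇒avoids (Good⇒CycGood (perm-bounded π) good)

    irredundant : ∀ {u v} → u ≢ v × (All (_< k) u × All (_< k) v) → ¬ RotEquiv (k ∷ u) (k ∷ v)
    irredundant (u≢v , u<k , _) r = u≢v (Rot-max-head-injective u<k (RotEquiv⇒Rot r))

    complete : ∀ σ → IsPerm (suc k) σ → ¬ CycContains σ p → Any (λ ρ → RotEquiv ρ σ) (map (k ∷_) (words k))
    complete σ π av with a , s , refl ← ∈-∃++ (∈-resp-↭ (↭-sym π) (∈-upTo⁺ ≤-refl)) =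
      Any.map (λ { refl → Rot⇒RotEquiv (s≤s z≤n) (k ∷ s , a , refl , refl) })
        (∈-map⁺ (k ∷_) (words-complete k ρ
          (CycGood⇒Good (perm-bounded ρ) (Unique-resp-↭ (↭-sym ρ) (Unique.upTo⁺ k))
            (avoids⇒CycGood av ∘ Rot-trans (a , k ∷ s , refl , refl)))))
      where
      ρ : s ++ a ↭ upTo k
      ρ = drop-∷ (↭-trans (++-comm (k ∷ s) a) (↭-trans π (↭-sym (upTo-snoc-↭ k))))

-- The two patterns.

place-last-Ins : ∀ v → Ins 0 v (map suc v ++ [ 0 ])
place-last-Ins []      = front []
place-last-Ins (x ∷ v) = later (place-last-Ins v)

place-last-sorted : AllPairs _≥_ v → AllPairs _≥_ (map suc v ++ [ 0 ])
place-last-sorted s = AllPairs.++⁺ (AllPairs.map⁺ (AllPairs.map s≤s s)) ([] ∷ [])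
  (All.universal (λ _ → z≤n ∷ []) _)

-- In a decreasing word no raised letter can follow the 0.
place-last-only : Ins 0 v w → AllPairs _≥_ w → w ≡ map suc v ++ [ 0 ]
place-last-only {v = []}    (front _) _              = refl
place-last-only {v = _ ∷ _} (front _) ((() ∷ _) ∷ _)
place-last-only (later i) (_ ∷ s) = cong (_ ∷_) (place-last-only i s)

place-first-only : Ins 0 v w → AllPairs _≤_ w → w ≡ 0 ∷ map suc v
place-first-only (front _) _       = refl
place-first-only (later i) (r ∷ _) with () ← All.head (All-resp-↭ (Ins-↭ i) r)

same-order : ∀ {a b c d} → a < b → c < d →
  ((a < b → c < d) × (c < d → a < b)) × ((b < a → d < c) × (d < c → b < a))
same-order a<b c<d =
  ((λ _ → c<d) , (λ _ → a<b)) ,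
  ((λ b<a → contradiction b<a (<⇒≯ a<b)) , (λ d<c → contradiction d<c (<⇒≯ c<d)))

lit : ∀ a b {_ : True (a <? b)} → a < b
lit a b {t} = toWitness t

-- Groups the implications by the six pairs of letters, so that `same-order` settles one pair at a
-- time.
orderIso : ∀ {x y z w a b c d} →
  ((x < y → a < b) × (a < b → x < y)) × ((y < x → b < a) × (b < a → y < x)) →
  ((x < z → a < c) × (a < c → x < z)) × ((z < x → c < a) × (c < a → z < x)) →
  ((x < w → a < d) × (a < d → x < w)) × ((w < x → d < a) × (d < a → w < x)) →
  ((y < z → b < c) × (b < c → y < z)) × ((z < y → c < b) × (c < b → z < y)) →
  ((y < w → b < d) × (b < d → y < w)) × ((w < y → d < b) × (d < b → w < y)) →
  ((z < w → c < d) × (c < d → z < w)) × ((w < z → d < c) × (d < c → w < z)) →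
  OrderIso (pat x y z w) (pat a b c d)
orderIso ((xy , xy′) , (yx , yx′)) ((xz , xz′) , (zx , zx′)) ((xw , xw′) , (wx , wx′))
         ((yz , yz′) , (zy , zy′)) ((yw , yw′) , (wy , wy′)) ((zw , zw′) , (wz , wz′)) =
  xy , xy′ , xz , xz′ , xw , xw′ , yx , yx′ , yz , yz′ , yw , yw′ ,
  zx , zx′ , zy , zy′ , zw , zw′ , wx , wx′ , wy , wy′ , wz , wz′

iso1234⁻ : ∀ {x y z w} → OrderIso (pat x y z w) p1234 → x < y × y < z × y < w × ¬ z ≥ w
iso1234⁻ (_ , xy , _ , _ , _ , _ , _ , _ , _ , yz , _ , yw , _ , _ , _ , _ , _ , zw , _) =
  xy (lit 1 2) , yz (lit 2 3) , yw (lit 2 4) , <⇒≱ (zw (lit 3 4))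

iso1243⁻ : ∀ {x y z w} → OrderIso (pat x y z w) p1243 → x < y × y < z × y < w × ¬ z ≤ w
iso1243⁻ (_ , xy , _ , _ , _ , _ , _ , _ , _ , yz , _ , yw , _ , _ , _ , _ , _ , _ , _ , _ , _ , _ , _ , wz) =
  xy (lit 1 2) , yz (lit 2 4) , yw (lit 2 3) , <⇒≱ (wz (lit 3 4))

iso1234⁺ : ∀ {x y z w} → x < y → y < z → y < w → ¬ z ≥ w → OrderIso (pat x y z w) p1234
iso1234⁺ xy yz yw z≱w =
  orderIso (same-order xy (lit 1 2)) (same-order (<-trans xy yz) (lit 1 3))
           (same-order (<-trans xy yw) (lit 1 4))
           (same-order yz (lit 2 3)) (same-order yw (lit 2 4)) (same-order (≰⇒> z≱w) (lit 3 4))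

iso1243⁺ : ∀ {x y z w} → x < y → y < z → y < w → ¬ z ≤ w → OrderIso (pat x y z w) p1243
iso1243⁺ xy yz yw z≰w =
  orderIso (same-order xy (lit 1 2)) (same-order (<-trans xy yz) (lit 1 4))
           (same-order (<-trans xy yw) (lit 1 3))
           -- The last pair descends in 1243, so it is compared in reverse and the two halves are
           -- swapped back.
           (same-order yz (lit 2 4)) (same-order yw (lit 2 3)) (swap× (same-order (≰⇒> z≰w) (lit 3 4)))

theorem5p4 : (n : ℕ) → 2 ≤ n →
    CycAvCount n p1234 (formula n) × CycAvCount n p1243 (formula n)
theorem5p4 (suc k) _ =
  Cyclic.avCount p1234 _≥_ _≥?_ iso1234⁻ iso1234⁺ ≥-linearizes s≤s ≤-pred
    (λ v → map suc v ++ [ 0 ]) place-last-Ins place-last-sorted place-last-only k ,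
  Cyclic.avCount p1243 _≤_ _≤?_ iso1243⁻ iso1243⁺ ≤-linearizes s≤s ≤-pred
    (λ v → 0 ∷ map suc v) (λ _ → front (All.universal (λ _ → z≤n) _))
    (λ s → All.universal (λ _ → z≤n) _ ∷ AllPairs.map⁺ (AllPairs.map s≤s s)) place-first-only k
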